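{- Let $G$ and $H$ be finite graphs. Then $G$ and $H$ are strongly relationally equivalent if and only if their point-determining graphs $G_{\mathrm{pd}}$ and $H_{\mathrm{pd}}$ are isomorphic.
   Context: Graphs are finite and undirected, loops allowed. For a finite set $B$ and a relation $R\subseteq V_G\times B$ with full image (every $b\in B$ has some $v$ with $(v,b)\in R$), $G\ast R$ is the graph with vertex set $B$ and edge set $\{(a,b)\in B\times B: \exists (u,v)\in E_G,\ (u,a)\in R,\ (v,b)\in R\}$. All relations here are required to have full domain (every $v\in V_G$ is related to some $b\in B$). $R^+$ is the transpose of $R$. $G$ and $H$ are strongly relationally equivalent if there is a relation $R\subseteq V_G\times V_H$ with $G\ast R=H$ and $H\ast R^+=G$. $N_G(x)$ is the set of vertices adjacent to $x$ (containing $x$ iff $x$ has a loop). The point-determining graph $G_{\mathrm{pd}}$ has as vertices the classes of the equivalence relation $x\sim y\iff N_G(x)=N_G(y)$ on $V_G$; two classes $\sigma,\tau$ (possibly equal) are adjacent iff there are $x\in\sigma$, $y\in\tau$ with $(x,y)\in E_G$. -}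

module Defs where

open import Data.Fin.Base using (Fin)
open import Data.Nat.Base using (ℕ)
open import Data.Product.Base using (_×_; _,_; ∃; ∃₂; Σ-syntax)
open import Function.Base using (flip)
open import Function.Bundles using (Inverse) renaming (_⇔_ to _⇔ₜ_)
open import Level using (0ℓ)
open import Relation.Binary.Bundles using (Setoid)
open import Relation.Binary.Core using (Rel; REL; _⇔_)
open import Relation.Binary.Definitions using (Symmetric; _Respects₂_)
import Relation.Binary.Construct.On as On
import Relation.Binary.PropositionalEquality.Properties as ≡
open import Relation.Unary using (Pred; _≐_)
open import Relation.Unary.Relation.Binary.Equality using (≐-setoid)

open Setoid using (Carrier)

Finite : Setoid 0ℓ 0ℓ → Set
Finite V = Σ[ n ∈ ℕ ] Inverse V (≡.setoid (Fin n))

-- Undirected graphs, loops allowed. The vertices form a setoid so that the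
-- classes of an equivalence relation on vertices are again the vertices of
-- a graph.
record Graph (V : Setoid 0ℓ 0ℓ) : Set₁ where
  open Setoid V using (_≈_)
  field
    Edge      : Rel (Carrier V) 0ℓ
    Edge-resp : Edge Respects₂ _≈_
    Edge-sym  : Symmetric Edge

  N : Carrier V → Pred (Carrier V) 0ℓ
  N x = Edge x

open Graph using (Edge; Edge-resp; Edge-sym)

private
  variable
    V W : Setoid 0ℓ 0ℓ

-- Equality of graphs on the same vertex set.
infix 4 _≗ᴳ_
_≗ᴳ_ : Graph V → Graph V → Set
G ≗ᴳ H = Edge G ⇔ Edge H

record Relation (V W : Setoid 0ℓ 0ℓ) : Set₁ where
  private
    module V = Setoid V
    module W = Setoid W
  field
    rel        : REL V.Carrier W.Carrier 0ℓ
    resp       : ∀ {v v′ w w′} → v V.≈ v′ → w W.≈ w′ → rel v w → rel v′ w′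
    fullDomain : ∀ v → ∃ λ w → rel v w
    fullImage  : ∀ w → ∃ λ v → rel v w

open Relation using (rel; resp; fullDomain; fullImage)

infix 8 _⁺
_⁺ : Relation V W → Relation W V
R ⁺ = record
  { rel        = flip (rel R)
  ; resp       = λ w≈w′ v≈v′ → resp R v≈v′ w≈w′
  ; fullDomain = fullImage R
  ; fullImage  = fullDomain R
  }

infixl 7 _∗_
_∗_ : Graph V → Relation V W → Graph W
_∗_ {V} {W} G R = record
  { Edge      = λ a b → ∃₂ λ u v → Edge G u v × rel R u a × rel R v b
  ; Edge-resp =
      (λ b≈b′ (u , v , e , ua , vb) → u , v , e , ua , resp R V.refl b≈b′ vb) ,
      (λ a≈a′ (u , v , e , ua , vb) → u , v , e , resp R V.refl a≈a′ ua , vb)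
  ; Edge-sym  = λ (u , v , e , ua , vb) → v , u , Edge-sym G e , vb , ua
  }
  where module V = Setoid V

StronglyRelationallyEquivalent : Graph V → Graph W → Set₁
StronglyRelationallyEquivalent {V} {W} G H =
  Σ[ R ∈ Relation V W ] (G ∗ R ≗ᴳ H × H ∗ R ⁺ ≗ᴳ G)

-- The set of classes of x ∼ y ⇔ N x = N y, a class being given by any of
-- its members.
pdVertices : Graph V → Setoid 0ℓ 0ℓ
pdVertices {V} G = On.setoid (≐-setoid (Carrier V) 0ℓ) (Graph.N G)

pd : (G : Graph V) → Graph (pdVertices G)
pd {V} G = record
  { Edge      = λ σ τ → ∃₂ λ x y → x ∼ σ × y ∼ τ × Edge G x y
  ; Edge-resp =
      (λ τ∼τ′ (x , y , x∼σ , y∼τ , e) → x , y , x∼σ , P.trans {y} y∼τ τ∼τ′ , e) ,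
      (λ σ∼σ′ (x , y , x∼σ , y∼τ , e) → x , y , P.trans {x} x∼σ σ∼σ′ , y∼τ , e)
  ; Edge-sym  = λ (x , y , x∼σ , y∼τ , e) → y , x , y∼τ , x∼σ , Edge-sym G e
  }
  where
  module P = Setoid (pdVertices G)
  open P using () renaming (_≈_ to _∼_)

infix 4 _≅_
record _≅_ (G : Graph V) (H : Graph W) : Set where
  field
    bijection : Inverse V W
  open Inverse bijection using (to)
  field
    preserves-edges : ∀ x y → Edge G x y ⇔ₜ Edge H (to x) (to y)

{-# OPTIONS --safe #-}
-- The two equations G ∗ R = H and H ∗ R⁺ = G say together that R matches edges:
-- if u R a and v R b, then uv is an edge of G iff ab is an edge of H. As R has
-- full domain and full image, such a matching makes N u = N u′ equivalent to
-- N a = N a′ whenever u R a and u′ R a′, so picking any related vertex is a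
-- well-defined isomorphism of the point-determining graphs. Conversely, an
-- isomorphism f of the point-determining graphs gives the matching
-- u R a ⇔ f [u] = [a].
module Submission where

open import Defs
open import Data.Product.Base using (∃; _,_; proj₁; proj₂)
open import Function.Bundles using (_⇔_; Equivalence; Inverse; mk⇔)
open import Function.Construct.Composition using (_⇔-∘_)
open import Function.Construct.Symmetry using (⇔-sym)
open import Level using (0ℓ)
open import Relation.Binary.Bundles using (Setoid)

open Equivalence using (to; from)
open Graph using (Edge; Edge-resp; Edge-sym)
open Relation using (rel; fullDomain; fullImage)

private
  variable
    V W : Setoid 0ℓ 0ℓ

module _ (G : Graph V) where
  open Setoid V using (_≈_)
  open Setoid (pdVertices G) using (refl) renaming (_≈_ to _∼_)

  ≈⇒∼ : ∀ {x y} → x ≈ y → x ∼ y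
  ≈⇒∼ x≈y = proj₂ (Edge-resp G) x≈y , proj₂ (Edge-resp G) (Setoid.sym V x≈y)

  -- Equal neighbourhoods allow replacing the first endpoint of an edge; symmetry turns the second
  -- endpoint into a first one.
  Edge-resp-∼ : ∀ {x x′ y y′} → x ∼ x′ → y ∼ y′ → Edge G x y → Edge G x′ y′
  Edge-resp-∼ x∼x′ y∼y′ e =
    Edge-sym G (proj₁ y∼y′ (Edge-sym G (proj₁ x∼x′ e)))

  -- Edges do not depend on the members chosen from two classes, so adjacency of classes can be
  -- tested on any representatives.
  pd-Edge : ∀ x y → Edge (pd G) x y ⇔ Edge G x y
  pd-Edge x y = mk⇔
    (λ (_ , _ , x′∼x , y′∼y , e) → Edge-resp-∼ x′∼x y′∼y e)
    (λ e → x , y , refl {x} , refl {y} , e)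

EdgeMatching : Graph V → Graph W → Relation V W → Set
EdgeMatching G H R =
  ∀ {u v a b} → rel R u a → rel R v b → Edge G u v ⇔ Edge H a b

module _ (G : Graph V) (H : Graph W) where
  private
    module G∼ = Setoid (pdVertices G)
    module H∼ = Setoid (pdVertices H)

  strong⇒matching : ((R , _) : StronglyRelationallyEquivalent G H) →
                    EdgeMatching G H R
  strong⇒matching (R , G∗R≗H , H∗R⁺≗G) ua vb = mk⇔
    (λ e → proj₁ G∗R≗H (_ , _ , e , ua , vb))
    (λ e → proj₁ H∗R⁺≗G (_ , _ , e , ua , vb))

  matching⇒strong : ∀ R → EdgeMatching G H R → StronglyRelationallyEquivalent G H
  matching⇒strong R match = R , (G∗R⊆H , H⊆G∗R) , (H∗R⁺⊆G , G⊆H∗R⁺)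
    where
    G∗R⊆H : ∀ {a b} → Edge (G ∗ R) a b → Edge H a b
    G∗R⊆H (_ , _ , e , ua , vb) = to (match ua vb) e

    -- Full image provides preimages of both endpoints, and the matching lifts the edge to them;
    -- full domain does the same for `G⊆H∗R⁺`.
    H⊆G∗R : ∀ {a b} → Edge H a b → Edge (G ∗ R) a b
    H⊆G∗R {a} {b} e with u , ua ← fullImage R a | v , vb ← fullImage R b =
      u , v , from (match ua vb) e , ua , vb

    H∗R⁺⊆G : ∀ {u v} → Edge (H ∗ R ⁺) u v → Edge G u v
    H∗R⁺⊆G (_ , _ , e , ua , vb) = from (match ua vb) e

    G⊆H∗R⁺ : ∀ {u v} → Edge G u v → Edge (H ∗ R ⁺) u v
    G⊆H∗R⁺ {u} {v} e with a , ua ← fullDomain R u | b , vb ← fullDomain R v =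
      a , b , to (match ua vb) e , ua , vb

  -- A neighbour `b` of `a` has a preimage `v`; then `uv` is an edge, hence so is `u′v`, and the
  -- matching carries it to `a′b`. Applied to `R ⁺`, this gives the converse.
  matching-∼ : ∀ R → EdgeMatching G H R → ∀ {u u′ a a′} →
               rel R u a → rel R u′ a′ → u G∼.≈ u′ → a H∼.≈ a′
  matching-∼ R match ua u′a′ (Nu⊆Nu′ , Nu′⊆Nu) =
    (λ {b} e → let v , vb = fullImage R b in
      to (match u′a′ vb) (Nu⊆Nu′ (from (match ua vb) e))) ,
    (λ {b} e → let v , vb = fullImage R b in
      to (match ua vb) (Nu′⊆Nu (from (match u′a′ vb) e)))

  pd-iso⇒matching : pd G ≅ pd H → ∃ (EdgeMatching G H)
  pd-iso⇒matching iso = R , match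
    where
    open _≅_ iso
    module f = Inverse bijection

    R : Relation V W
    R = record
      { rel        = λ v w → f.to v H∼.≈ w
      ; resp       = λ {v} {v′} {w} {w′} v≈v′ w≈w′ fv∼w →
          H∼.trans {f.to v′} {f.to v} {w′}
            (f.to-cong {v′} {v} (≈⇒∼ G (Setoid.sym V v≈v′)))
            (H∼.trans {f.to v} {w} {w′} fv∼w (≈⇒∼ H w≈w′))
      ; fullDomain = λ v → f.to v , H∼.refl {f.to v}
      ; fullImage  = λ w → f.from w , f.strictlyInverseˡ w
      }

    match : EdgeMatching G H R
    match {u} {v} {a} {b} fu∼a fv∼b =
      -- Read from the bottom up: the edge `uv` passes to `pd G`, along the isomorphism to `pd H`,
      -- down to the images of `u` and `v` in `H`, and finally to `ab`.
      mk⇔ (Edge-resp-∼ H {f.to u} {a} {f.to v} {b} fu∼a fv∼b)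
          (Edge-resp-∼ H {a} {f.to u} {b} {f.to v}
            (H∼.sym {f.to u} {a} fu∼a) (H∼.sym {f.to v} {b} fv∼b))
      ⇔-∘ (pd-Edge H (f.to u) (f.to v)
      ⇔-∘ (preserves-edges u v
      ⇔-∘ ⇔-sym (pd-Edge G u v)))

matching⇒pd-iso : (G : Graph V) (H : Graph W) (R : Relation V W) →
                  EdgeMatching G H R → pd G ≅ pd H
matching⇒pd-iso G H R match = record
  { bijection = record
    { to        = λ v → proj₁ (fullDomain R v)
    ; from      = λ w → proj₁ (fullImage R w)
    ; to-cong   = λ {u} {v} →
        matching-∼ G H R match (related u) (related v)
    ; from-cong = λ {a} {b} →
        matching-∼ H G (R ⁺) match⁺ (related⁺ a) (related⁺ b)
    ; inverse   =
        -- `from a` is related to `a`, and `u` to its image; so if `u` and `from a` lie in one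
        -- class, the image of `u` lies in the class of `a`.
        (λ {a} {u} → matching-∼ G H R match (related u) (related⁺ a)) ,
        (λ {u} {a} → matching-∼ H G (R ⁺) match⁺ (related⁺ a) (related u))
    }
  ; preserves-edges = λ u v →
      ⇔-sym (pd-Edge H _ _) ⇔-∘ (match (related u) (related v) ⇔-∘ pd-Edge G u v)
  }
  where
  related : ∀ v → rel R v (proj₁ (fullDomain R v))
  related v = proj₂ (fullDomain R v)

  related⁺ : ∀ w → rel R (proj₁ (fullImage R w)) w
  related⁺ w = proj₂ (fullImage R w)

  match⁺ : EdgeMatching H G (R ⁺)
  match⁺ ua vb = ⇔-sym (match ua vb)

theorem4p2p4 : (V W : Setoid 0ℓ 0ℓ) → Finite V → Finite W →
    (G : Graph V) (H : Graph W) →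
    StronglyRelationallyEquivalent G H ⇔ (pd G ≅ pd H)
theorem4p2p4 V W _ _ G H = mk⇔
  (λ equiv → matching⇒pd-iso G H (proj₁ equiv) (strong⇒matching G H equiv))
  (λ iso → let R , match = pd-iso⇒matching G H iso in matching⇒strong G H R match)
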